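{- The following $m$-equivalences hold: (1) $\{111,1221\}\sim\{111,2112\}$; (2) $\{112,1211\}\sim\{121,1112\}$.
   Context: A (finite, reduced) multiset is $S=1^{a_1}2^{a_2}\cdots k^{a_k}$ with $k\ge 1$ and all $a_i\ge 1$, meaning that $i$ occurs with multiplicity $a_i$. A multipermutation of $S$ is a word having exactly $a_i$ occurrences of each letter $i\in[k]=\{1,\dots,k\}$ and no other letters. A word $\pi=\pi_1\cdots\pi_n$ contains a pattern (word) $\rho=\rho_1\cdots\rho_\ell$ if there are indices $i(1)<\cdots<i(\ell)$ such that for all $a,b\in[\ell]$: $\pi_{i(a)}<\pi_{i(b)}$ iff $\rho_a<\rho_b$, and $\pi_{i(a)}>\pi_{i(b)}$ iff $\rho_a>\rho_b$; otherwise $\pi$ avoids $\rho$. For a set $P$ of patterns, $\mathrm{av}(S;P)$ is the number of multipermutations of $S$ that avoid every pattern in $P$. Two sets of patterns $P,Q$ are $m$-equivalent, written here $P\sim Q$, if $\mathrm{av}(S;P)=\mathrm{av}(S;Q)$ for every multiset $S$. -}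

module Defs where

open import Data.Fin.Base as Fin using (Fin; toℕ)
import Data.Fin.Properties as Fin
open import Data.List.Base using (List; []; _∷_; [_]; length; lookup; map; filter; upTo; tabulate; cartesianProductWith)
open import Data.List.Relation.Unary.All as All using (All)
open import Data.Nat.Base using (ℕ; zero; suc; _≤_; _<_; _>_)
open import Data.Nat.ListAction using (sum)
open import Data.Nat.Properties using (_≟_; _≤?_; _<?_)
open import Data.Product.Base using (∃; ∃-syntax; _×_; _,_)
open import Data.Vec.Base as Vec using (Vec; []; _∷_)
open import Function.Bundles using (_⇔_; mk⇔; module Equivalence)
open import Relation.Binary.PropositionalEquality.Core using (_≡_)
open import Relation.Nullary.Decidable using (Dec; map′; ¬?; _×-dec_; _→-dec_)
open import Relation.Nullary.Negation.Core using (¬_)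
open import Relation.Unary using (Pred; Decidable)
open import Level using (0ℓ)

Word : Set
Word = List ℕ

infix 4 _contains_ _contains?_ _avoids_ _∼_

-- mult i is the multiplicity of the letter suc (toℕ i), so that the letters
-- are 1, …, k although Fin k starts from zero.
record Multiset : Set where
  field
    k      : ℕ
    k≥1    : 1 ≤ k
    mult   : Fin k → ℕ
    mult≥1 : ∀ i → 1 ≤ mult i

  size : ℕ
  size = sum (tabulate mult)

open Multiset

occurrences : ℕ → Word → ℕ
occurrences x π = length (filter (x ≟_) π)

IsMultipermutation : Multiset → Word → Set
IsMultipermutation S π =
  All (λ x → 1 ≤ x × x ≤ k S) π ×
  (∀ (i : Fin (k S)) → occurrences (suc (toℕ i)) π ≡ mult S i)

StrictlyIncreasing : ∀ {n ℓ} → Vec (Fin n) ℓ → Set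
StrictlyIncreasing i = ∀ a b → a Fin.< b → Vec.lookup i a Fin.< Vec.lookup i b

-- The word of the letters of π at the positions i is order isomorphic to ρ.
OrderIsomorphicAt : (π ρ : Word) → Vec (Fin (length π)) (length ρ) → Set
OrderIsomorphicAt π ρ i = ∀ a b →
  (lookup π (Vec.lookup i a) < lookup π (Vec.lookup i b) ⇔ lookup ρ a < lookup ρ b) ×
  (lookup π (Vec.lookup i a) > lookup π (Vec.lookup i b) ⇔ lookup ρ a > lookup ρ b)

_contains_ : Word → Word → Set
π contains ρ = ∃[ i ] StrictlyIncreasing i × OrderIsomorphicAt π ρ i

_avoids_ : Word → Word → Set
π avoids ρ = ¬ (π contains ρ)

-- A finite set of patterns is given by a list of its elements.
AvoidsAll : List Word → Word → Set
AvoidsAll P π = All (π avoids_) P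

_⇔-dec_ : {A B : Set} → Dec A → Dec B → Dec (A ⇔ B)
a? ⇔-dec b? = map′ (λ (f , g) → mk⇔ f g)
                   (λ e → Equivalence.to e , Equivalence.from e)
                   ((a? →-dec b?) ×-dec (b? →-dec a?))

anyVec? : ∀ {n} ℓ {Q : Pred (Vec (Fin n) ℓ) 0ℓ} → Decidable Q → Dec (∃ Q)
anyVec? zero    Q? = map′ (λ q → [] , q) (λ { ([] , q) → q }) (Q? [])
anyVec? (suc ℓ) Q? = map′ (λ (x , xs , q) → x ∷ xs , q)
                          (λ { (x ∷ xs , q) → x , xs , q })
                          (Fin.any? λ x → anyVec? ℓ λ xs → Q? (x ∷ xs))

strictlyIncreasing? : ∀ {n ℓ} → Decidable (StrictlyIncreasing {n} {ℓ})
strictlyIncreasing? i = Fin.all? λ a → Fin.all? λ b →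
  (a Fin.<? b) →-dec (Vec.lookup i a Fin.<? Vec.lookup i b)

orderIsomorphicAt? : ∀ π ρ → Decidable (OrderIsomorphicAt π ρ)
orderIsomorphicAt? π ρ i = Fin.all? λ a → Fin.all? λ b →
  ((lookup π (Vec.lookup i a) <? lookup π (Vec.lookup i b)) ⇔-dec (lookup ρ a <? lookup ρ b)) ×-dec
  ((lookup π (Vec.lookup i b) <? lookup π (Vec.lookup i a)) ⇔-dec (lookup ρ b <? lookup ρ a))

_contains?_ : ∀ π ρ → Dec (π contains ρ)
π contains? ρ = anyVec? (length ρ) λ i →
  strictlyIncreasing? i ×-dec orderIsomorphicAt? π ρ i

avoidsAll? : ∀ P → Decidable (AvoidsAll P)
avoidsAll? P π = All.all? (λ ρ → ¬? (π contains? ρ)) P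

isMultipermutation? : ∀ S → Decidable (IsMultipermutation S)
isMultipermutation? S π =
  All.all? (λ x → (1 ≤? x) ×-dec (x ≤? k S)) π ×-dec
  Fin.all? (λ i → occurrences (suc (toℕ i)) π ≟ mult S i)

-- Every word of length n over the letters xs, each listed exactly once when xs
-- has no repeated entry.
words : List ℕ → ℕ → List Word
words xs zero    = [ [] ]
words xs (suc n) = cartesianProductWith _∷_ xs (words xs n)

-- A multipermutation of S has length size S, so filtering the words of that
-- length over 1, …, k yields each multipermutation exactly once.
multipermutations : Multiset → List Word
multipermutations S =
  filter (isMultipermutation? S) (words (map suc (upTo (k S))) (size S))

av : Multiset → List Word → ℕ
av S P = length (filter (avoidsAll? P) (multipermutations S))

_∼_ : List Word → List Word → Set
P ∼ Q = ∀ S → av S P ≡ av S Q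

{-# OPTIONS --safe #-}
module Submission where

-- An occurrence of ρ in π is a map f, strictly increasing on the letters of ρ,
-- such that f(ρ) is a subsequence of π.
--
-- (1) Avoiding 111, only letters of multiplicity two can play a part in 1221 or
-- 2112, so reversing the order of those letters, and fixing all others,
-- exchanges the two classes without changing any multiplicity.
--
-- (2) All four patterns start with their smallest letter, so π is in one of the
-- classes iff its word of non-minimal letters is, and no pattern begins at the
-- minimal letter x. Say x has b + 1 copies, the first of them after u and before
-- v in the rest u v. Then avoidance forces π = u x v x^b for {112,1211} and
-- π = u x x^b v for {121,1112}, in both cases with b ≤ 1 or v empty, and these
-- conditions suffice. Recursively, the two classes correspond.

open import Defs
open import Data.Fin.Base as Fin using (Fin; zero; suc; toℕ; fromℕ<; opposite; punchOut)
import Data.Fin.Properties as Fin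
open import Data.List.Base using (List; []; _∷_; _++_; length; lookup; map; filter; replicate; take; drop; upTo)
open import Data.List.Extrema.Nat using (min; argmin-sel; min≤⊤; min≤xs)
open import Data.List.Membership.DecPropositional using () renaming (_∈?_ to member?)
open import Data.List.Membership.Propositional using (_∈_; _∉_)
open import Data.List.Membership.Propositional.Properties
open import Data.List.Properties
open import Data.List.Relation.Binary.Permutation.Propositional using (_↭_; refl; ↭-sym; ↭-trans; prep; module PermutationReasoning)
import Data.List.Relation.Binary.Permutation.Propositional.Properties as ↭
open import Data.List.Relation.Binary.Sublist.Propositional using (_⊆_; []; _∷_; _∷ʳ_; ⊆-trans; to∈; from∈; minimum)
open import Data.List.Relation.Binary.Sublist.Propositional.Properties as ⊆ using (∷ʳ⁻; ∷ˡ⁻; ∷⁻; filter-⊆)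
open import Data.List.Relation.Unary.All as All using (All; []; _∷_)
import Data.List.Relation.Unary.All.Properties as All
open import Data.List.Relation.Unary.AllPairs as AllPairs using (AllPairs; []; _∷_)
import Data.List.Relation.Unary.AllPairs.Properties as AllPairs
open import Data.List.Relation.Unary.Any as Any using (here; there)
import Data.List.Relation.Unary.Any.Properties as Any
open import Data.List.Relation.Unary.Unique.Propositional using (Unique)
import Data.List.Relation.Unary.Unique.Propositional.Properties as Unique
open import Data.Nat.Base using (ℕ; zero; suc; _+_; _∸_; _≤_; _<_; z≤n; s≤s)
open import Data.Nat.Properties
open import Data.Product.Base using (∃₂; ∃-syntax; _×_; _,_; proj₁; proj₂)
open import Data.Sum.Base using (_⊎_; inj₁; inj₂)
open import Data.Vec.Base as Vec using (Vec; []; _∷_)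
import Data.Vec.Properties as Vec
open import Function.Base using (_∘_; id)
open import Function.Bundles using (mk⇔; module Equivalence)
open import Relation.Binary.Definitions using (tri<; tri≈; tri>)
open import Relation.Binary.PropositionalEquality
open import Relation.Nullary.Decidable using (Dec; yes; no; True; toWitness; _⊎-dec_; _×-dec_)
open import Relation.Nullary.Negation using (¬_; contradiction)

-- Pattern containment as order-preserving embedding of letters

StrictMonoOn : Word → (ℕ → ℕ) → Set
StrictMonoOn ρ f = ∀ {p q} → p ∈ ρ → q ∈ ρ → p < q → f p < f q

punchDown : ∀ {ℓ n} (i : Fin ℓ → Fin (suc n)) → (∀ a → Fin.zero ≢ i a) →
            ∃[ j ] (∀ a → Fin.suc (j a) ≡ i a)
punchDown i 0≢i = (λ a → punchOut (0≢i a)) , λ a → Fin.punchIn-punchOut (0≢i a)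

-- Induction on `π`. Since `i zero` is the least chosen position, it decides whether the head of `π`
-- is matched or skipped; in both cases the remaining positions are nonzero and can be lowered by
-- one.
increasing⇒⊆ : ∀ (σ π : Word) (i : Fin (length σ) → Fin (length π)) →
               (∀ a b → a Fin.< b → i a Fin.< i b) →
               (∀ a → lookup σ a ≡ lookup π (i a)) → σ ⊆ π
increasing⇒⊆ []      π       i inc eq = minimum π
increasing⇒⊆ (x ∷ σ) []      i inc eq with () ← i zero
increasing⇒⊆ (x ∷ σ) (y ∷ π) i inc eq with i zero in i₀
... | zero = trans (eq zero) (cong (lookup (y ∷ π)) i₀) ∷ increasing⇒⊆ σ π j
        (λ a b a<b → ≤-pred (subst₂ Fin._<_ (sym (sj a)) (sym (sj b)) (inc (suc a) (suc b) (s≤s a<b))))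
        (λ a → trans (eq (suc a)) (cong (lookup (y ∷ π)) (sym (sj a))))
  where
  lower = punchDown (i ∘ suc) λ a 0≡i →
    contradiction (inc zero (suc a) (s≤s z≤n)) (λ lt → n≮0 {toℕ (i zero)} (subst (i zero Fin.<_) (sym 0≡i) lt))
  j  = proj₁ lower
  sj = proj₂ lower
... | suc k = y ∷ʳ increasing⇒⊆ (x ∷ σ) π j
        (λ a b a<b → ≤-pred (subst₂ Fin._<_ (sym (sj a)) (sym (sj b)) (inc a b a<b)))
        (λ a → trans (eq a) (cong (lookup (y ∷ π)) (sym (sj a))))
  where
  0≢i : ∀ a → Fin.zero ≢ i a
  0≢i zero    0≡i = Fin.0≢1+n (trans 0≡i i₀)
  0≢i (suc a) 0≡i = n≮0 (subst (i zero Fin.<_) (sym 0≡i) (inc zero (suc a) (s≤s z≤n)))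
  lower = punchDown i 0≢i
  j  = proj₁ lower
  sj = proj₂ lower

⊆⇒increasing : ∀ f (ρ : Word) {π : Word} → map f ρ ⊆ π →
               ∃[ i ] StrictlyIncreasing i × (∀ a → lookup π (Vec.lookup {n = length ρ} i a) ≡ f (lookup ρ a))
⊆⇒increasing f []      σ⊆π = [] , (λ ()) , λ ()
⊆⇒increasing f (p ∷ ρ) (y ∷ʳ σ⊆π) with i , inc , eq ← ⊆⇒increasing f (p ∷ ρ) σ⊆π =
  Vec.map suc i ,
  (λ a b a<b → subst₂ Fin._<_ (sym (Vec.lookup-map a suc i)) (sym (Vec.lookup-map b suc i)) (s≤s (inc a b a<b))) ,
  λ a → trans (cong (lookup _) (Vec.lookup-map a suc i)) (eq a)
⊆⇒increasing f (p ∷ ρ) {y ∷ π} (fp≡y ∷ σ⊆π) with i , inc , eq ← ⊆⇒increasing f ρ σ⊆π =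
  zero ∷ Vec.map suc i , inc′ , eq′
  where
  inc′ : StrictlyIncreasing (zero ∷ Vec.map suc i)
  inc′ zero    (suc b) _         = subst (zero {length π} Fin.<_) (sym (Vec.lookup-map b suc i)) (s≤s z≤n)
  inc′ (suc a) (suc b) (s≤s a<b) =
    subst₂ Fin._<_ (sym (Vec.lookup-map a suc i)) (sym (Vec.lookup-map b suc i)) (s≤s (inc a b a<b))
  eq′ : ∀ a → lookup (y ∷ π) (Vec.lookup (zero ∷ Vec.map suc i) a) ≡ f (lookup (p ∷ ρ) a)
  eq′ zero    = sym fp≡y
  eq′ (suc a) = trans (cong (lookup (y ∷ π)) (Vec.lookup-map a suc i)) (eq a)

-- Monotonicity gives one direction of each required equivalence. The other follows by trichotomy,
-- because a function of letters sends equal letters to equal letters.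
embedding⇒contains : ∀ f {π : Word} ρ → StrictMonoOn ρ f → map f ρ ⊆ π → π contains ρ
embedding⇒contains f {π} ρ mono ⊆π with i , inc , eq ← ⊆⇒increasing f ρ ⊆π =
  i , inc , λ a b → mk⇔ (reflects a b) (preserves a b) , mk⇔ (reflects b a) (preserves b a)
  where
  preserves : ∀ a b → lookup ρ a < lookup ρ b → lookup π (Vec.lookup i a) < lookup π (Vec.lookup i b)
  preserves a b lt = subst₂ _<_ (sym (eq a)) (sym (eq b)) (mono (∈-lookup a) (∈-lookup b) lt)
  reflects : ∀ a b → lookup π (Vec.lookup i a) < lookup π (Vec.lookup i b) → lookup ρ a < lookup ρ b
  reflects a b lt with <-cmp (lookup ρ a) (lookup ρ b)
  ... | tri< ρa<ρb _ _ = ρa<ρb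
  ... | tri≈ _ ρa≡ρb _ = contradiction lt (<-irrefl (trans (eq a) (trans (cong f ρa≡ρb) (sym (eq b)))))
  ... | tri> _ _ ρb<ρa = contradiction lt (<-asym (preserves b a ρb<ρa))

-- An occurrence assigns letters of `π` to positions of `ρ`. Order isomorphism makes equal letters
-- of `ρ` receive equal letters of `π`, so the assignment descends to a function of letters.
contains⇒embedding : ∀ {π : Word} ρ → π contains ρ → ∃[ f ] StrictMonoOn ρ f × map f ρ ⊆ π
contains⇒embedding {π} ρ (i , inc , iso) = f , mono ,
  increasing⇒⊆ (map f ρ) π (Vec.lookup i ∘ Fin.cast (length-map f ρ))
    (λ a b a<b → inc _ _ (subst₂ _<_ (sym (Fin.toℕ-cast _ a)) (sym (Fin.toℕ-cast _ b)) a<b))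
    (λ a → trans (lookup-map′ ρ a) (f-lookup (Fin.cast (length-map f ρ) a)))
  where
  letter : Fin (length ρ) → ℕ
  letter a = lookup π (Vec.lookup i a)
  value : ∀ {p} → Dec (p ∈ ρ) → ℕ
  value (yes p∈ρ) = letter (Any.index p∈ρ)
  -- An arbitrary default: only values at letters of `ρ` enter the conclusion.
  value (no _)    = 0
  f : ℕ → ℕ
  f p = value (member? _≟_ p ρ)
  letter-cong : ∀ a b → lookup ρ a ≡ lookup ρ b → letter a ≡ letter b
  letter-cong a b ρa≡ρb with <-cmp (letter a) (letter b)
  ... | tri< lt _ _ = contradiction (Equivalence.to (proj₁ (iso a b)) lt) (<-irrefl ρa≡ρb)
  ... | tri≈ _ eq _ = eq
  ... | tri> _ _ gt = contradiction (Equivalence.to (proj₂ (iso a b)) gt) (<-irrefl (sym ρa≡ρb))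
  f-lookup : ∀ a → f (lookup ρ a) ≡ letter a
  f-lookup a with member? _≟_ (lookup ρ a) ρ
  ... | yes p∈ρ = letter-cong _ a (sym (Any.lookup-index p∈ρ))
  ... | no  p∉ρ = contradiction (∈-lookup a) p∉ρ
  lookup-map′ : ∀ ρ′ a → lookup (map f ρ′) a ≡ f (lookup ρ′ (Fin.cast (length-map f ρ′) a))
  lookup-map′ (p ∷ ρ′) zero    = refl
  lookup-map′ (p ∷ ρ′) (suc a) = lookup-map′ ρ′ a
  mono : StrictMonoOn ρ f
  mono p∈ρ q∈ρ p<q rewrite Any.lookup-index p∈ρ | Any.lookup-index q∈ρ
    = subst₂ _<_ (sym (f-lookup _)) (sym (f-lookup _)) (Equivalence.from (proj₁ (iso _ _)) p<q)

⊆-avoids : ∀ {σ π : Word} ρ → σ ⊆ π → π avoids ρ → σ avoids ρ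
⊆-avoids ρ σ⊆π π-avoids σ-contains with f , mono , ⊆σ ← contains⇒embedding ρ σ-contains =
  π-avoids (embedding⇒contains f ρ mono (⊆-trans ⊆σ σ⊆π))

letters : ℕ → ℕ → ℕ → ℕ
letters x y 1 = x
letters x y _ = y

-- For a concrete pattern the `True` argument is solved by evaluation and `map (letters x y) ρ`
-- computes to an explicit word, so an occurrence can be given as a literal sublist.
twoLetters⇒contains : ∀ {x y} {π : Word} ρ {_ : True (All.all? (λ p → (p ≟ 1) ⊎-dec (p ≟ 2)) ρ)} →
                      x < y → map (letters x y) ρ ⊆ π → π contains ρ
twoLetters⇒contains {x} {y} ρ {ok} x<y = embedding⇒contains (letters x y) ρ
  λ p∈ρ q∈ρ → mono (All.lookup (toWitness ok) p∈ρ) (All.lookup (toWitness ok) q∈ρ)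
  where
  mono : ∀ {p q} → p ≡ 1 ⊎ p ≡ 2 → q ≡ 1 ⊎ q ≡ 2 → p < q → letters x y p < letters x y q
  mono (inj₁ refl) (inj₂ refl) _   = x<y
  mono (inj₁ refl) (inj₁ refl) 1<1 = contradiction 1<1 (<-irrefl refl)
  mono (inj₂ refl) (inj₂ refl) 2<2 = contradiction 2<2 (<-irrefl refl)
  mono (inj₂ refl) (inj₁ refl) 2<1 = contradiction 2<1 (<-asym (s≤s (s≤s z≤n)))

-- Comparing counts through injective relations

length-≤-by-injection : ∀ {A : Set} (R : A → A → Set) → (∀ {x y z} → R x z → R y z → x ≡ y) →
                        ∀ {xs ys} → Unique xs → (∀ {x} → x ∈ xs → ∃[ y ] y ∈ ys × R x y) →
                        length xs ≤ length ys
length-≤-by-injection R inj {[]}     {ys} _          image = z≤n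
length-≤-by-injection R inj {x ∷ xs} {ys} (x∉xs ∷ uniq) image
  with y , y∈ys , xRy ← image (here refl)
  with as , bs , refl ← ∈-∃++ y∈ys = begin
    suc (length xs)         ≤⟨ s≤s (length-≤-by-injection R inj uniq image′) ⟩
    suc (length (as ++ bs)) ≡⟨ length-++-sucʳ as y bs ⟨
    length (as ++ y ∷ bs)   ∎
  where
  open ≤-Reasoning
  image′ : ∀ {x′} → x′ ∈ xs → ∃[ z ] z ∈ as ++ bs × R x′ z
  image′ x′∈xs with z , z∈ys , x′Rz ← image (there x′∈xs) with ∈-++⁻ as z∈ys
  ... | inj₁ z∈as         = z , ∈-++⁺ˡ z∈as , x′Rz
  ... | inj₂ (there z∈bs) = z , ∈-++⁺ʳ as z∈bs , x′Rz
  -- The image `y` of the head has been removed from `ys`; a later entry with the same image would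
  -- equal the head and repeat it.
  ... | inj₂ (here refl)  = contradiction (inj xRy x′Rz) (All.lookup x∉xs x′∈xs)

words-unique : ∀ {xs} n → Unique xs → Unique (words xs n)
words-unique zero    uniq = [] ∷ []
words-unique (suc n) uniq = Unique.cartesianProductWith⁺ _∷_ ∷-injective uniq (words-unique n uniq)

∈-words⁺ : ∀ {xs} π → All (_∈ xs) π → π ∈ words xs (length π)
∈-words⁺ []      []           = here refl
∈-words⁺ (x ∷ π) (x∈xs ∷ π∈) = ∈-cartesianProductWith⁺ _∷_ x∈xs (∈-words⁺ π π∈)

∈-words⇒length : ∀ xs n {π} → π ∈ words xs n → length π ≡ n
∈-words⇒length xs zero    (here refl) = refl
∈-words⇒length xs (suc n) π∈
  with _ , _ , _ , w∈ , refl ← ∈-cartesianProductWith⁻ _∷_ xs (words xs n) π∈ =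
  cong suc (∈-words⇒length xs n w∈)

open Multiset

-- A relation replaces a function because the image of a word may be built from the proof that the
-- word avoids `P`. The length condition places `π′` among the words of length `size S`, a length
-- that `π` has because it was drawn from `words`.
av-≤-by-injection : ∀ S P Q (R : Word → Word → Set) → (∀ {x y z} → R x z → R y z → x ≡ y) →
  (∀ {π} → IsMultipermutation S π → AvoidsAll P π →
     ∃[ π′ ] IsMultipermutation S π′ × AvoidsAll Q π′ × length π′ ≡ length π × R π π′) →
  av S P ≤ av S Q
av-≤-by-injection S P Q R inj image = length-≤-by-injection R inj
  (Unique.filter⁺ (avoidsAll? P) (Unique.filter⁺ (isMultipermutation? S)
    (words-unique (size S) (Unique.map⁺ suc-injective (Unique.upTo⁺ (k S))))))
  image′
  where
  letter∈ : ∀ {x} → 1 ≤ x × x ≤ k S → x ∈ map suc (upTo (k S))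
  letter∈ {suc x} (_ , x<k) = ∈-map⁺ suc (∈-upTo⁺ x<k)
  image′ : ∀ {π} → π ∈ filter (avoidsAll? P) (multipermutations S) →
           ∃[ π′ ] π′ ∈ filter (avoidsAll? Q) (multipermutations S) × R π π′
  image′ π∈
    with π∈ms , avoids ← ∈-filter⁻ (avoidsAll? P) {xs = multipermutations S} π∈
    with π∈ws , multi ← ∈-filter⁻ (isMultipermutation? S) {xs = words (map suc (upTo (k S))) (size S)} π∈ms
    with π′ , multi′ , avoids′ , len , πRπ′ ← image multi avoids =
    π′ , ∈-filter⁺ (avoidsAll? Q) (∈-filter⁺ (isMultipermutation? S)
      (subst (λ n → π′ ∈ words _ n) (trans len (∈-words⇒length _ (size S) π∈ws))
        (∈-words⁺ π′ (All.map letter∈ (proj₁ multi′)))) multi′) avoids′ , πRπ′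

-- Reversing the order of the doubled letters

module Reversal (D : List ℕ) (sorted : AllPairs _<_ D) where

  lookup-< : ∀ {xs : List ℕ} → AllPairs _<_ xs → ∀ i j → i Fin.< j → lookup xs i < lookup xs j
  lookup-< (x< ∷ _)     zero    (suc j) _         = All.lookup x< (∈-lookup j)
  lookup-< (_ ∷ sorted) (suc i) (suc j) (s≤s i<j) = lookup-< sorted i j i<j

  lookup-injective : ∀ i j → lookup D i ≡ lookup D j → i ≡ j
  lookup-injective i j eq with Fin.<-cmp i j
  ... | tri< i<j _ _ = contradiction (lookup-< sorted i j i<j) (<-irrefl eq)
  ... | tri≈ _ i≡j _ = i≡j
  ... | tri> _ _ j<i = contradiction (lookup-< sorted j i j<i) (<-irrefl (sym eq))

  lookup-<⁻ : ∀ i j → lookup D i < lookup D j → i Fin.< j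
  lookup-<⁻ i j lt with Fin.<-cmp i j
  ... | tri< i<j _ _  = i<j
  ... | tri≈ _ refl _ = contradiction lt (<-irrefl refl)
  ... | tri> _ _ j<i  = contradiction (lookup-< sorted j i j<i) (<-asym lt)

  reverseWithin : ∀ {x} → Dec (x ∈ D) → ℕ
  reverseWithin     (yes x∈D) = lookup D (opposite (Any.index x∈D))
  reverseWithin {x} (no _)    = x

  σ : ℕ → ℕ
  σ x = reverseWithin (member? _≟_ x D)

  σ-outside : ∀ {x} → x ∉ D → σ x ≡ x
  σ-outside {x} x∉D with member? _≟_ x D
  ... | yes x∈D = contradiction x∈D x∉D
  ... | no _    = refl

  σ-lookup : ∀ i → σ (lookup D i) ≡ lookup D (opposite i)
  σ-lookup i with member? _≟_ (lookup D i) D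
  -- The index found by `member?` is `i` itself, since a strictly increasing list has no
  -- repetitions.
  ... | yes x∈D = cong (lookup D ∘ opposite) (sym (lookup-injective i _ (Any.lookup-index x∈D)))
  ... | no  x∉D = contradiction (∈-lookup i) x∉D

  σ-∈ : ∀ {x} → x ∈ D → σ x ∈ D
  σ-∈ x∈D rewrite Any.lookup-index x∈D | σ-lookup (Any.index x∈D) = ∈-lookup _

  σ-involutive : ∀ x → σ (σ x) ≡ x
  σ-involutive x with member? _≟_ x D
  ... | yes x∈D = begin
    σ (lookup D (opposite i))          ≡⟨ σ-lookup (opposite i) ⟩
    lookup D (opposite (opposite i))   ≡⟨ cong (lookup D) (Fin.opposite-involutive i) ⟩
    lookup D i                         ≡⟨ Any.lookup-index x∈D ⟨
    x                                  ∎
    where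
    open ≡-Reasoning
    i = Any.index x∈D
  ... | no x∉D  = σ-outside x∉D

  opposite-< : ∀ {n} (i j : Fin n) → i Fin.< j → opposite j Fin.< opposite i
  opposite-< i j i<j = subst₂ _<_ (sym (Fin.opposite-prop j)) (sym (Fin.opposite-prop i))
    (∸-monoʳ-< (s≤s i<j) (Fin.toℕ<n j))

  σ-antitone : ∀ {x y} → x ∈ D → y ∈ D → x < y → σ y < σ x
  σ-antitone x∈D y∈D x<y
    rewrite Any.lookup-index x∈D | Any.lookup-index y∈D
          | σ-lookup (Any.index x∈D) | σ-lookup (Any.index y∈D)
    = lookup-< sorted _ _ (opposite-< _ _ (lookup-<⁻ _ _ x<y))

occurrences-accept : ∀ {x y} π → x ≡ y → occurrences x (y ∷ π) ≡ suc (occurrences x π)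
occurrences-accept π x≡y = cong length (filter-accept (_ ≟_) {xs = π} x≡y)

occurrences-reject : ∀ {x y} π → x ≢ y → occurrences x (y ∷ π) ≡ occurrences x π
occurrences-reject π x≢y = cong length (filter-reject (_ ≟_) {xs = π} x≢y)

occurrences-map : ∀ {σ : ℕ → ℕ} → (∀ x → σ (σ x) ≡ x) → ∀ x π → occurrences x (map σ π) ≡ occurrences (σ x) π
occurrences-map inv x [] = refl
occurrences-map {σ} inv x (y ∷ π) with σ x ≟ y
... | yes refl = begin
  occurrences x (σ (σ x) ∷ map σ π)   ≡⟨ occurrences-accept (map σ π) (sym (inv x)) ⟩
  suc (occurrences x (map σ π))       ≡⟨ cong suc (occurrences-map inv x π) ⟩
  suc (occurrences (σ x) π)           ≡⟨ occurrences-accept π refl ⟨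
  occurrences (σ x) (σ x ∷ π)         ∎
  where open ≡-Reasoning
... | no σx≢y = begin
  occurrences x (σ y ∷ map σ π)   ≡⟨ occurrences-reject (map σ π) (λ x≡σy → σx≢y (trans (cong σ x≡σy) (inv y))) ⟩
  occurrences x (map σ π)         ≡⟨ occurrences-map inv x π ⟩
  occurrences (σ x) π             ≡⟨ occurrences-reject π σx≢y ⟨
  occurrences (σ x) (y ∷ π)       ∎
  where open ≡-Reasoning

replicate-⊆⇒≤ : ∀ n x π → replicate n x ⊆ π → n ≤ occurrences x π
replicate-⊆⇒≤ n x π x̄⊆π = begin
  n                                         ≡⟨ length-replicate n ⟨
  length (replicate n x)                    ≡⟨ cong length (filter-all (x ≟_) (All.replicate⁺ n refl)) ⟨
  occurrences x (replicate n x)             ≤⟨ ⊆.length-mono-≤ (⊆.filter⁺ (x ≟_) (x ≟_) (λ { refl → id }) x̄⊆π) ⟩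
  occurrences x π                           ∎
  where open ≤-Reasoning

≤⇒replicate-⊆ : ∀ n x π → n ≤ occurrences x π → replicate n x ⊆ π
≤⇒replicate-⊆ zero    x π       n≤ = minimum π
≤⇒replicate-⊆ (suc n) x (y ∷ π) n≤ with x ≟ y
... | yes refl = refl ∷ ≤⇒replicate-⊆ n x π (≤-pred (subst (suc n ≤_) (occurrences-accept π refl) n≤))
... | no x≢y   = y ∷ʳ ≤⇒replicate-⊆ (suc n) x π (subst (suc n ≤_) (occurrences-reject π x≢y) n≤)

module ReverseDoubled (S : Multiset) where

  -- Read off from `S` and not from a word, so that a single involution `σ` serves all
  -- multipermutations of `S`.
  Doubled : ℕ → Set
  Doubled x = ∃[ i ] x ≡ suc (toℕ i) × mult S i ≡ 2

  doubled? : ∀ x → Dec (Doubled x)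
  doubled? x = Fin.any? λ i → (x ≟ suc (toℕ i)) ×-dec (mult S i ≟ 2)

  doubledLetters : List ℕ
  -- The range is 0, ..., k; the filter drops 0, as a doubled letter is a successor.
  doubledLetters = filter doubled? (upTo (suc (k S)))

  doubledLetters-sorted : AllPairs _<_ doubledLetters
  doubledLetters-sorted = AllPairs.filter⁺ doubled? (AllPairs.applyUpTo⁺₁ id (suc (k S)) λ i<j _ → i<j)

  doubled⇒∈ : ∀ {x} → Doubled x → x ∈ doubledLetters
  doubled⇒∈ d@(i , refl , _) = ∈-filter⁺ doubled? (∈-upTo⁺ (s≤s (Fin.toℕ<n i))) d

  ∈⇒doubled : ∀ {x} → x ∈ doubledLetters → Doubled x
  ∈⇒doubled = proj₂ ∘ ∈-filter⁻ doubled? {xs = upTo (suc (k S))}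

  open Reversal doubledLetters doubledLetters-sorted

  σ-range : ∀ {x} → 1 ≤ x × x ≤ k S → 1 ≤ σ x × σ x ≤ k S
  σ-range {x} x-range with member? _≟_ x doubledLetters
  ... | no  _   = x-range
  ... | yes x∈D with i , eq , _ ← ∈⇒doubled (∈-lookup {xs = doubledLetters} (opposite (Any.index x∈D)))
    rewrite eq = s≤s z≤n , Fin.toℕ<n i

  -- `σ` permutes the letters of multiplicity two among themselves and fixes all others, so it
  -- always sends a letter to one of the same multiplicity.
  σ-multipermutation : ∀ {π} → IsMultipermutation S π → IsMultipermutation S (map σ π)
  σ-multipermutation {π} (range , mults) = All.map⁺ (All.map σ-range range) , λ i →
    trans (occurrences-map σ-involutive (suc (toℕ i)) π) (σ-mult i)
    where
    σ-mult : ∀ i → occurrences (σ (suc (toℕ i))) π ≡ mult S i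
    σ-mult i with doubled? (suc (toℕ i))
    ... | no ¬d = trans (cong (λ x → occurrences x π) (σ-outside (¬d ∘ ∈⇒doubled))) (mults i)
    ... | yes d@(i′ , eq′ , mult₂) with j , eq , mult₂′ ← ∈⇒doubled (σ-∈ (doubled⇒∈ d))
      rewrite Fin.toℕ-injective (suc-injective eq′) | eq = trans (mults j) (trans mult₂′ (sym mult₂))

  -- The multiplicity is at least two because of the given subsequence, and at most two because
  -- three copies would form 111.
  repeated⇒doubled : ∀ {π x} → IsMultipermutation S π → π avoids (1 ∷ 1 ∷ 1 ∷ []) →
                     x ∷ x ∷ [] ⊆ π → Doubled x
  repeated⇒doubled {π} {x} (range , mults) no-111 ⊆π = go x (All.lookup range (to∈ ⊆π)) ⊆π
    where
    go : ∀ x → 1 ≤ x × x ≤ k S → x ∷ x ∷ [] ⊆ π → Doubled x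
    go (suc x) (_ , x<k) ⊆π = i , eq ,
      trans (sym (mults i)) (≤-antisym at-most (replicate-⊆⇒≤ 2 _ π (subst (λ z → z ∷ z ∷ [] ⊆ π) eq ⊆π)))
      where
      i  = fromℕ< x<k
      eq = cong suc (sym (Fin.toℕ-fromℕ< x<k))
      at-most : occurrences (suc (toℕ i)) π ≤ 2
      -- The pattern 111 has no letter 2, so any number above the repeated letter can stand for it;
      -- its successor is taken.
      at-most = ≮⇒≥ λ 2< → no-111 (twoLetters⇒contains _ (n<1+n _) (≤⇒replicate-⊆ 3 _ π 2<))

  -- Apply `σ` to both sides and cancel `σ ∘ σ` on the right.
  reflect : ∀ {τ π} → τ ⊆ map σ π → map σ τ ⊆ π
  reflect {π = π} τ⊆ = subst (_ ⊆_)
    (trans (sym (map-∘ π)) (map-id-local (All.universal σ-involutive π))) (⊆.map⁺ σ τ⊆)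

  σ-avoids-111 : ∀ π → π avoids (1 ∷ 1 ∷ 1 ∷ []) → map σ π avoids (1 ∷ 1 ∷ 1 ∷ [])
  σ-avoids-111 π no-111 occurrence with f , _ , ⊆π ← contains⇒embedding {map σ π} _ occurrence =
    no-111 (twoLetters⇒contains {π = π} _ (n<1+n _) (reflect ⊆π))

  -- `σ x` and `σ y` occur twice in `π`, hence are doubled; applying `σ` once more shows that `x`
  -- and `y` lie in `doubledLetters`, where `σ` reverses the order.
  σ-antitone-repeated : ∀ {π x y} → IsMultipermutation S π → π avoids (1 ∷ 1 ∷ 1 ∷ []) → x < y →
    σ x ∷ σ x ∷ [] ⊆ π → σ y ∷ σ y ∷ [] ⊆ π → σ y < σ x
  σ-antitone-repeated multi no-111 x<y x⊆ y⊆ = σ-antitone (member x⊆) (member y⊆) x<y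
    where
    member : ∀ {x} → σ x ∷ σ x ∷ [] ⊆ _ → x ∈ doubledLetters
    member ⊆π = subst (_∈ doubledLetters) (σ-involutive _) (σ-∈ (doubled⇒∈ (repeated⇒doubled multi no-111 ⊆π)))

  module _ {π} (multi : IsMultipermutation S π) (no-111 : π avoids (1 ∷ 1 ∷ 1 ∷ [])) where

    σ-avoids-2112 : π avoids (1 ∷ 2 ∷ 2 ∷ 1 ∷ []) → map σ π avoids (2 ∷ 1 ∷ 1 ∷ 2 ∷ [])
    σ-avoids-2112 no-ρ occurrence with f , mono , ⊆π ← contains⇒embedding {map σ π} _ occurrence =
      -- The reflected occurrence reads `σ (f 2)`, `σ (f 1)`, `σ (f 1)`, `σ (f 2)`. Both letters are
      -- repeated, so `σ (f 2) < σ (f 1)` and this is a 1221 in `π`.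
      no-ρ (twoLetters⇒contains {π = π} _
        (σ-antitone-repeated multi no-111 (mono (there (here refl)) (here refl) (n<1+n 1))
          (⊆-trans (_ ∷ʳ refl ∷ refl ∷ _ ∷ʳ []) (reflect ⊆π))
          (⊆-trans (refl ∷ _ ∷ʳ _ ∷ʳ refl ∷ []) (reflect ⊆π)))
        (reflect ⊆π))

    σ-avoids-1221 : π avoids (2 ∷ 1 ∷ 1 ∷ 2 ∷ []) → map σ π avoids (1 ∷ 2 ∷ 2 ∷ 1 ∷ [])
    σ-avoids-1221 no-ρ occurrence with f , mono , ⊆π ← contains⇒embedding {map σ π} _ occurrence =
      no-ρ (twoLetters⇒contains {π = π} _
        (σ-antitone-repeated multi no-111 (mono (here refl) (there (here refl)) (n<1+n 1))
          (⊆-trans (refl ∷ _ ∷ʳ _ ∷ʳ refl ∷ []) (reflect ⊆π))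
          (⊆-trans (_ ∷ʳ refl ∷ refl ∷ _ ∷ʳ []) (reflect ⊆π)))
        (reflect ⊆π))

  map-σ-injective : ∀ {π π′ τ} → τ ≡ map σ π → τ ≡ map σ π′ → π ≡ π′
  map-σ-injective refl = map-injective λ {x} {y} eq →
    trans (sym (σ-involutive x)) (trans (cong σ eq) (σ-involutive y))

  image : ∀ {ρ ρ′ π} →
    (∀ {π} → IsMultipermutation S π → π avoids (1 ∷ 1 ∷ 1 ∷ []) → π avoids ρ → map σ π avoids ρ′) →
    IsMultipermutation S π → AvoidsAll ((1 ∷ 1 ∷ 1 ∷ []) ∷ ρ ∷ []) π →
    ∃[ π′ ] IsMultipermutation S π′ × AvoidsAll ((1 ∷ 1 ∷ 1 ∷ []) ∷ ρ′ ∷ []) π′ × length π′ ≡ length π × π′ ≡ map σ π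
  image {π = π} σ-avoids-ρ′ multi (no-111 ∷ no-ρ ∷ []) =
    map σ π , σ-multipermutation multi ,
    σ-avoids-111 π no-111 ∷ σ-avoids-ρ′ multi no-111 no-ρ ∷ [] , length-map σ π , refl

111,1221∼111,2112 : ((1 ∷ 1 ∷ 1 ∷ []) ∷ (1 ∷ 2 ∷ 2 ∷ 1 ∷ []) ∷ []) ∼ ((1 ∷ 1 ∷ 1 ∷ []) ∷ (2 ∷ 1 ∷ 1 ∷ 2 ∷ []) ∷ [])
111,1221∼111,2112 S = ≤-antisym
  (av-≤-by-injection S _ _ _ map-σ-injective (image σ-avoids-2112))
  (av-≤-by-injection S _ _ _ map-σ-injective (image σ-avoids-1221))
  where open ReverseDoubled S

-- Inserting the copies of a new minimal letter

splitAtMin : ∀ {x} π → All (x ≤_) π →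
             All (x <_) π ⊎ ∃₂ λ u s → π ≡ u ++ x ∷ s × All (x <_) u × All (x ≤_) s
splitAtMin []      [] = inj₁ []
splitAtMin {x} (y ∷ π) (x≤y ∷ x≤) with x ≟ y
... | yes refl = inj₂ ([] , π , refl , [] , x≤)
... | no x≢y with splitAtMin π x≤
... | inj₁ x<                      = inj₁ (≤∧≢⇒< x≤y x≢y ∷ x<)
... | inj₂ (u , s , refl , x<u , x≤s) = inj₂ (y ∷ u , s , refl , ≤∧≢⇒< x≤y x≢y ∷ x<u , x≤s)

splitAtOccurringMin : ∀ {x} π → x ∈ π → All (x ≤_) π →
                      ∃₂ λ u s → π ≡ u ++ x ∷ s × All (x <_) u × All (x ≤_) s
splitAtOccurringMin π x∈π x≤ with splitAtMin π x≤
... | inj₁ x<    = contradiction (All.lookup x< x∈π) (<-irrefl refl)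
... | inj₂ split = split

-- The second alternative exhibits a larger letter followed by `x`; preceded by an earlier copy of
-- `x` it becomes an occurrence of 121.
stripMin : ∀ {x} π → All (x ≤_) π →
           ∃₂ λ b v → π ≡ replicate b x ++ v ×
             (All (x <_) v ⊎ ∃[ q ] x < q × q ∷ x ∷ [] ⊆ v)
stripMin []      [] = 0 , [] , refl , inj₁ []
stripMin {x} (y ∷ π) (x≤y ∷ x≤) with x ≟ y
... | yes refl with b , v , refl , rest ← stripMin π x≤ = suc b , v , refl , rest
... | no x≢y with splitAtMin π x≤
... | inj₁ x<                   = 0 , y ∷ π , refl , inj₁ (≤∧≢⇒< x≤y x≢y ∷ x<)
... | inj₂ (u , s , refl , _ , _) = 0 , y ∷ π , refl , inj₂ (y , ≤∧≢⇒< x≤y x≢y , refl ∷ ⊆.++⁺ˡ u (refl ∷ minimum s))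

∷-⊆-++⁻ : ∀ {y : ℕ} {τ} u {s} → y ∉ u → y ∷ τ ⊆ u ++ s → y ∷ τ ⊆ s
∷-⊆-++⁻ []      y∉u τ⊆ = τ⊆
∷-⊆-++⁻ (z ∷ u) y∉u τ⊆ = ∷-⊆-++⁻ u (y∉u ∘ there) (∷ʳ⁻ (λ y≡z → y∉u (here y≡z)) τ⊆)

All<⇒∉ : ∀ {x π} → All (x <_) π → x ∉ π
All<⇒∉ x<π x∈π = <-irrefl refl (All.lookup x<π x∈π)

>⇒∉replicate : ∀ {x y} b → x < y → y ∉ replicate b x
>⇒∉replicate b x<y y∈ = <-irrefl (All.lookup (All.replicate⁺ {P = λ z → _ ≡ z} b refl) y∈) x<y

all≡⇒replicate : ∀ {x} {π : Word} → All (x ≡_) π → π ≡ replicate (length π) x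
all≡⇒replicate []           = refl
all≡⇒replicate (refl ∷ eqs) = cong (_ ∷_) (all≡⇒replicate eqs)

replicate-length : ∀ {b b′} {x : ℕ} → replicate b x ≡ replicate b′ x → b ≡ b′
replicate-length {b} {b′} eq = trans (sym (length-replicate b)) (trans (cong length eq) (length-replicate b′))

filter-<-replicate : ∀ x b → filter (x <?_) (replicate b x) ≡ []
filter-<-replicate x b = filter-none (x <?_) (All.replicate⁺ b (<-irrefl refl))

filter-<-++-∷ : ∀ {x} {u : Word} s → All (x <_) u → filter (x <?_) (u ++ x ∷ s) ≡ u ++ filter (x <?_) s
filter-<-++-∷ {x} {u} s x<u = trans (filter-++ (x <?_) u (x ∷ s))
  (cong₂ _++_ (filter-all (x <?_) x<u) (filter-reject (x <?_) (<-irrefl refl)))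

-- The displayed `x` is the first letter of the word that does not exceed `x`, so the word
-- determines the cut.
++-∷-injective : ∀ {x} {u u′ s s′ : Word} → All (x <_) u → All (x <_) u′ →
                 u ++ x ∷ s ≡ u′ ++ x ∷ s′ → u ≡ u′ × s ≡ s′
++-∷-injective []         []         refl = refl , refl
++-∷-injective []         (x<y ∷ _)  refl = contradiction x<y (<-irrefl refl)
++-∷-injective (x<y ∷ _)  []         refl = contradiction x<y (<-irrefl refl)
++-∷-injective (_ ∷ x<u)  (_ ∷ x<u′) eq
  with refl , eq′ ← ∷-injective eq
  with refl , refl ← ++-∷-injective x<u x<u′ eq′ = refl , refl

++-injective : ∀ {u u′ v v′ : Word} → length u ≡ length u′ → u ++ v ≡ u′ ++ v′ → u ≡ u′ × v ≡ v′
++-injective {[]}    {[]}     _   eq = refl , eq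
++-injective {_ ∷ u} {_ ∷ u′} len eq
  with refl , eq′ ← ∷-injective eq
  with refl , refl ← ++-injective {u} {u′} (suc-injective len) eq′ = refl , refl

occurringMin : ∀ y (π : Word) → ∃[ x ] x ∈ y ∷ π × All (x ≤_) (y ∷ π)
occurringMin y π = min y π , occurs (argmin-sel id y π) , min≤⊤ y π ∷ min≤xs y π
  where
  occurs : min y π ≡ y ⊎ min y π ∈ π → min y π ∈ y ∷ π
  occurs (inj₁ eq) = here eq
  occurs (inj₂ m∈) = there m∈

-- `b` counts the copies of the minimum beyond the first. Two of these, the first copy and a letter
-- of `v` would form 1211 in one class and 1112 in the other.
Admissible : ℕ → Word → Set
Admissible b v = b ≤ 1 ⊎ v ≡ []

-- join x b u v inserts the suc b copies of a new smallest letter x into u ++ v,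
-- the first of them between u and v.
record MinInsertion (P : List Word) : Set where
  field
    join           : ℕ → ℕ → Word → Word → Word
    join-↭         : ∀ x b u v → join x b u v ↭ replicate (suc b) x ++ u ++ v
    join-filter    : ∀ {x b u v} → All (x <_) u → All (x <_) v → filter (x <?_) (join x b u v) ≡ u ++ v
    join-injective : ∀ {x b b′ u u′ v v′} → All (x <_) u → All (x <_) v → All (x <_) u′ → All (x <_) v′ →
                     join x b u v ≡ join x b′ u′ v′ → b ≡ b′ × u ≡ u′ × v ≡ v′
    decompose      : ∀ {x π} → x ∈ π → All (x ≤_) π → AvoidsAll P π →
                     ∃[ b ] ∃₂ λ u v → π ≡ join x b u v × All (x <_) u × All (x <_) v × Admissible b v
    compose        : ∀ {x b u v} → All (x <_) u → All (x <_) v → Admissible b v →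
                     AvoidsAll P (u ++ v) → AvoidsAll P (join x b u v)

  join-All-≤ : ∀ {x b u v} → All (x <_) u → All (x <_) v → All (x ≤_) (join x b u v)
  join-All-≤ {x} {b} x<u x<v = ↭.All-resp-↭ (↭-sym (join-↭ x b _ _))
    (All.++⁺ (All.replicate⁺ (suc b) ≤-refl) (All.map <⇒≤ (All.++⁺ x<u x<v)))

  ∈-join : ∀ x b u v → x ∈ join x b u v
  ∈-join x b u v = ↭.∈-resp-↭ (↭-sym (join-↭ x b u v)) (here refl)

  -- Each of `x` and `y` occurs in the common word and bounds it from below.
  join-min-unique : ∀ {x y b c u v s t} → All (x <_) u → All (x <_) v → All (y <_) s → All (y <_) t →
                    join x b u v ≡ join y c s t → x ≡ y
  join-min-unique {x} {y} {b} {c} {u} {v} {s} {t} x<u x<v y<s y<t eq = ≤-antisym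
    (All.lookup (join-All-≤ {b = b} x<u x<v) (subst (y ∈_) (sym eq) (∈-join y c s t)))
    (All.lookup (join-All-≤ {b = c} y<s y<t) (subst (x ∈_) eq (∈-join x b u v)))

  -- The remainder arises by filtering, hence is a subsequence and inherits avoidance.
  join-⊆ : ∀ {x b u v} → All (x <_) u → All (x <_) v → u ++ v ⊆ join x b u v
  join-⊆ {x} {b} {u} {v} x<u x<v = subst (_⊆ join x b u v) (join-filter x<u x<v) (filter-⊆ (x <?_) (join x b u v))

  join-length : ∀ x b u v → length (u ++ v) < length (join x b u v)
  join-length x b u v = begin-strict
    length (u ++ v)                          ≤⟨ length-++-≤ʳ (u ++ v) {replicate b x} ⟩
    length (replicate b x ++ u ++ v)         <⟨ n<1+n _ ⟩
    length (replicate (suc b) x ++ u ++ v)   ≡⟨ ↭.↭-length (join-↭ x b u v) ⟨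
    length (join x b u v)                    ∎
    where open ≤-Reasoning

-- The correspondence induced by two insertion schemes

open MinInsertion

-- The graph of the recursive correspondence: related remainders receive equally many copies of the
-- minimum, the first at the same position. The equations for `π` and `π′` are arguments because
-- `join` is an arbitrary function, which unification of indices could not invert. Recording the
-- conditions on both sides makes the relation symmetric.
data Related {P Q} (J : MinInsertion P) (K : MinInsertion Q) : Word → Word → Set where
  []   : Related J K [] []
  step : ∀ {x b u v u′ v′ π π′} →
         All (x <_) u → All (x <_) v → All (x <_) u′ → All (x <_) v′ →
         length u ≡ length u′ → Admissible b v → Admissible b v′ →
         Related J K (u ++ v) (u′ ++ v′) →
         π ≡ join J x b u v → π′ ≡ join K x b u′ v′ → Related J K π π′

module _ {P Q} {J : MinInsertion P} {K : MinInsertion Q} where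

  Related-sym : ∀ {π π′} → Related J K π π′ → Related K J π′ π
  Related-sym [] = []
  Related-sym (step x<u x<v x<u′ x<v′ len adm adm′ r eq eq′) =
    step x<u′ x<v′ x<u x<v (sym len) adm′ adm (Related-sym r) eq′ eq

  Related⇒↭ : ∀ {π π′} → Related J K π π′ → π ↭ π′
  Related⇒↭ [] = refl
  Related⇒↭ (step {x} {b} {u} {v} {u′} {v′} _ _ _ _ _ _ _ r refl refl) =
    ↭-trans (join-↭ J x b u v) (↭-trans (↭.++⁺ˡ (replicate (suc b) x) (Related⇒↭ r)) (↭-sym (join-↭ K x b u′ v′)))

  join≢[] : ∀ {x b u v} → join K x b u v ≢ []
  join≢[] {x} {b} {u} {v} eq with () ← subst (x ∈_) eq (∈-join K x b u v)

  -- The common word determines its minimum, the number of copies and both parts of its remainder.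
  -- By induction the remainders on the left agree, and the equal lengths of the first parts say
  -- where to cut them.
  Related-injective : ∀ {π₁ π₂ π′} → Related J K π₁ π′ → Related J K π₂ π′ → π₁ ≡ π₂
  Related-injective [] [] = refl
  Related-injective [] (step _ _ _ _ _ _ _ _ _ eq) = contradiction (sym eq) join≢[]
  Related-injective (step _ _ _ _ _ _ _ _ _ eq) [] = contradiction (sym eq) join≢[]
  Related-injective (step {x} {b} {u} {v} _ _ x<u x<v len _ _ r refl refl)
                    (step {y} {_} {s} {t} _ _ y<s y<t len′ _ _ r′ refl eq)
    with refl ← join-min-unique K x<u x<v y<s y<t eq
    with refl , refl , refl ← join-injective K x<u x<v y<s y<t eq
    with refl , refl ← ++-injective {u} {s} {v} {t} (trans len (sym len′)) (Related-injective r r′) = refl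

  Related⇒AvoidsAll : AvoidsAll Q [] → ∀ {π π′} → Related J K π π′ → AvoidsAll Q π′
  Related⇒AvoidsAll avoids-[] [] = avoids-[]
  Related⇒AvoidsAll avoids-[] (step _ _ x<u′ x<v′ _ _ adm′ r _ refl) =
    compose K x<u′ x<v′ adm′ (Related⇒AvoidsAll avoids-[] r)

  -- The bound `n` drives the recursion, since the remainder `u ++ v` is shorter than the word but
  -- not a structural part of it.
  AvoidsAll⇒Related : ∀ n π → length π ≤ n → AvoidsAll P π → ∃[ π′ ] Related J K π π′
  AvoidsAll⇒Related n       []      _         _      = [] , []
  AvoidsAll⇒Related (suc n) (y ∷ π) (s≤s len) avoids
    with x , x∈ , x≤ ← occurringMin y π
    with b , u , v , eq , x<u , x<v , adm ← decompose J x∈ x≤ avoids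
    with τ , r ← AvoidsAll⇒Related n (u ++ v) 
             (≤-trans (≤-pred (subst (length (u ++ v) <_) (cong length (sym eq)) (join-length J x b u v))) len)
             (All.map (λ {ρ} → ⊆-avoids ρ (subst (u ++ v ⊆_) (sym eq) (join-⊆ J x<u x<v))) avoids)
    -- The related remainder `τ` is cut after `length u` letters, so the first copy of `x` keeps its
    -- position.
    = join K x b (take m τ) (drop m τ) ,
      step x<u x<v (All.take⁺ m x<τ) (All.drop⁺ m x<τ) (sym |take|) adm (adm′ adm)
        (subst (Related J K (u ++ v)) (sym (take++drop≡id m τ)) r) eq refl
    where
    m = length u
    x<τ : All (x <_) τ
    x<τ = ↭.All-resp-↭ (Related⇒↭ r) (All.++⁺ x<u x<v)
    |τ| : length τ ≡ m + length v
    |τ| = trans (sym (↭.↭-length (Related⇒↭ r))) (length-++ u)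
    |take| : length (take m τ) ≡ m
    |take| = trans (length-take m τ) (m≤n⇒m⊓n≡m (subst (m ≤_) (sym |τ|) (m≤m+n m _)))
    adm′ : Admissible b v → Admissible b (drop m τ)
    adm′ (inj₁ b≤1)  = inj₁ b≤1
    -- If `v` is empty then `τ` has length `m`, so nothing is left after the cut.
    adm′ (inj₂ refl) = inj₂ (empty (trans (length-drop m τ) (trans (cong (_∸ m) |τ|) (m+n∸m≡n m 0))))
      where
      empty : ∀ {w : Word} → length w ≡ 0 → w ≡ []
      empty {[]} _ = refl

  av-≤-by-minInsertion : AvoidsAll Q [] → ∀ S → av S P ≤ av S Q
  av-≤-by-minInsertion avoids-[] S = av-≤-by-injection S P Q (Related J K) Related-injective image
    where
    image : ∀ {π} → IsMultipermutation S π → AvoidsAll P π →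
            ∃[ π′ ] IsMultipermutation S π′ × AvoidsAll Q π′ × length π′ ≡ length π × Related J K π π′
    image {π} (range , mults) avoids with π′ , r ← AvoidsAll⇒Related (length π) π ≤-refl avoids =
      π′ ,
      (↭.All-resp-↭ π↭π′ range ,
       λ i → trans (sym (↭.↭-length (↭.filter-↭ (suc (toℕ i) ≟_) π↭π′))) (mults i)) ,
      Related⇒AvoidsAll avoids-[] r , sym (↭.↭-length π↭π′) , r
      where π↭π′ = Related⇒↭ r

-- The pattern starts with its smallest letter `p`. An occurrence with `f p` equal to `x` is
-- excluded by the last hypothesis; in any other, all letters exceed `x`, so it survives the filter
-- and lies in `π′`.
avoids-by-min : ∀ {x π π′ p} ρ → All (p ≤_) ρ → All (x ≤_) π → filter (x <?_) π ≡ π′ → π′ avoids (p ∷ ρ) →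
                (∀ f → StrictMonoOn (p ∷ ρ) f → f p ≡ x → ¬ (map f (p ∷ ρ) ⊆ π)) → π avoids (p ∷ ρ)
avoids-by-min {x} {π} {p = p} ρ p≤ x≤ refl filter-avoids no-min occurrence
  with f , mono , ⊆π ← contains⇒embedding {π} (p ∷ ρ) occurrence
  with x ≟ f p
... | yes x≡fp = no-min f mono (sym x≡fp) ⊆π
... | no  x≢fp = filter-avoids (embedding⇒contains f (p ∷ ρ) mono
        (subst (_⊆ filter (x <?_) π) (filter-all (x <?_) x<) (⊆.filter⁺ (x <?_) (x <?_) (λ { refl → id }) ⊆π)))
  where
  x<fp : x < f p
  x<fp = ≤∧≢⇒< (All.lookup x≤ (to∈ ⊆π)) x≢fp
  x<f : ∀ {q} → q ∈ p ∷ ρ → x < f q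
  x<f {q} q∈ with m≤n⇒m<n∨m≡n (All.lookup (≤-refl ∷ p≤) q∈)
  ... | inj₁ p<q  = <-trans x<fp (mono (here refl) q∈ p<q)
  ... | inj₂ refl = x<fp
  x< : All (x <_) (map f (p ∷ ρ))
  x< = All.map⁺ (All.tabulate x<f)

-- The insertion schemes of the two classes

[]-avoids : ∀ p ρ → [] avoids (p ∷ ρ)
[]-avoids p ρ (() ∷ _ , _)

all≥1 : ∀ {ρ} {_ : True (All.all? (1 ≤?_) ρ)} → All (1 ≤_) ρ
all≥1 {_} {ok} = toWitness ok

lastCopies : MinInsertion ((1 ∷ 1 ∷ 2 ∷ []) ∷ (1 ∷ 2 ∷ 1 ∷ 1 ∷ []) ∷ [])
lastCopies = record
  { join           = join′
  ; join-↭         = join′-↭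
  ; join-filter    = join′-filter
  ; join-injective = join′-injective
  ; decompose      = decompose′
  ; compose        = compose′
  }
  where
  join′ : ℕ → ℕ → Word → Word → Word
  join′ x b u v = u ++ x ∷ v ++ replicate b x

  join′-↭ : ∀ x b u v → join′ x b u v ↭ replicate (suc b) x ++ u ++ v
  join′-↭ x b u v = begin
    u ++ x ∷ v ++ replicate b x          ↭⟨ ↭.shift x u (v ++ replicate b x) ⟩
    x ∷ u ++ v ++ replicate b x          ≡⟨ cong (x ∷_) (++-assoc u v (replicate b x)) ⟨
    x ∷ (u ++ v) ++ replicate b x        ↭⟨ prep x (↭.++-comm (u ++ v) (replicate b x)) ⟩
    x ∷ replicate b x ++ u ++ v          ∎
    where open PermutationReasoning

  tail-filter : ∀ x b v → All (x <_) v → filter (x <?_) (v ++ replicate b x) ≡ v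
  tail-filter x b v x<v = trans (filter-++ (x <?_) v _)
    (trans (cong₂ _++_ (filter-all (x <?_) x<v) (filter-<-replicate x b)) (++-identityʳ v))

  join′-filter : ∀ {x b u v} → All (x <_) u → All (x <_) v → filter (x <?_) (join′ x b u v) ≡ u ++ v
  join′-filter {x} {b} {u} {v} x<u x<v = trans (filter-<-++-∷ _ x<u) (cong (u ++_) (tail-filter x b v x<v))

  join′-injective : ∀ {x b b′ u u′ v v′} → All (x <_) u → All (x <_) v → All (x <_) u′ → All (x <_) v′ →
                    join′ x b u v ≡ join′ x b′ u′ v′ → b ≡ b′ × u ≡ u′ × v ≡ v′
  join′-injective {x} {b} {b′} {v = v} {v′} x<u x<v x<u′ x<v′ eq
    with refl , tails ← ++-∷-injective x<u x<u′ eq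
    with refl ← trans (sym (tail-filter x b v x<v)) (trans (cong (filter (x <?_)) tails) (tail-filter x b′ v′ x<v′))
    = replicate-length (++-cancelˡ v _ _ tails) , refl , refl

  decompose′ : ∀ {x π} → x ∈ π → All (x ≤_) π → AvoidsAll _ π →
               ∃[ b ] ∃₂ λ u v → π ≡ join′ x b u v × All (x <_) u × All (x <_) v × Admissible b v
  decompose′ {x} {π} x∈ x≤ (no-112 ∷ no-1211 ∷ [])
    with u , s , refl , x<u , x≤s ← splitAtOccurringMin π x∈ x≤
    with splitAtMin s x≤s
  ... | inj₁ x<s = 0 , u , s , cong (λ w → u ++ x ∷ w) (sym (++-identityʳ s)) , x<u , x<s , inj₁ z≤n
  ... | inj₂ (v , r , refl , x<v , x≤r) = suc (length r) , u , v ,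
        cong (λ w → u ++ x ∷ v ++ x ∷ w) (all≡⇒replicate x≡r) , x<u , x<v , admissible r v x≡r x<v no-1211
    where
    -- Two copies of `x` precede `r`, so a larger letter in `r` would complete 112.
    x≡r : All (x ≡_) r
    x≡r = All.tabulate λ {q} q∈r → ≤-antisym (All.lookup x≤r q∈r) (≮⇒≥ λ x<q →
      no-112 (twoLetters⇒contains _ x<q (⊆.++⁺ˡ u (refl ∷ ⊆.++⁺ˡ v (refl ∷ from∈ q∈r)))))
    admissible : ∀ r v → All (x ≡_) r → All (x <_) v → u ++ x ∷ v ++ x ∷ r avoids (1 ∷ 2 ∷ 1 ∷ 1 ∷ []) →
                 Admissible (suc (length r)) v
    admissible []      v       _          _         _       = inj₁ ≤-refl
    admissible (_ ∷ r) []      _          _         _       = inj₂ refl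
    admissible (_ ∷ r) (q ∷ v) (refl ∷ _) (x<q ∷ _) no-1211 = contradiction
      (twoLetters⇒contains _ x<q (⊆.++⁺ˡ u (refl ∷ refl ∷ ⊆.++⁺ˡ v (refl ∷ refl ∷ minimum r)))) no-1211

  compose′ : ∀ {x b u v} → All (x <_) u → All (x <_) v → Admissible b v →
             AvoidsAll ((1 ∷ 1 ∷ 2 ∷ []) ∷ (1 ∷ 2 ∷ 1 ∷ 1 ∷ []) ∷ []) (u ++ v) →
             AvoidsAll ((1 ∷ 1 ∷ 2 ∷ []) ∷ (1 ∷ 2 ∷ 1 ∷ 1 ∷ []) ∷ []) (join′ x b u v)
  compose′ {x} {b} {u} {v} x<u x<v adm (no-112 ∷ no-1211 ∷ []) =
    avoids-by-min _ all≥1 x≤ eq no-112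
      (λ { f mono refl occ → no-min-112 (mono (here refl) (there (there (here refl))) (n<1+n 1)) occ }) ∷
    avoids-by-min _ all≥1 x≤ eq no-1211
      (λ { f mono refl occ → no-min-1211 adm (mono (here refl) (there (here refl)) (n<1+n 1)) occ }) ∷ []
    where
    eq = join′-filter {b = b} x<u x<v
    x≤ : All (x ≤_) (join′ x b u v)
    x≤ = All.++⁺ (All.map <⇒≤ x<u) (≤-refl ∷ All.++⁺ (All.map <⇒≤ x<v) (All.replicate⁺ b ≤-refl))
    no-min-112 : ∀ {q} → x < q → ¬ (x ∷ x ∷ q ∷ [] ⊆ join′ x b u v)
    no-min-112 x<q occ = >⇒∉replicate b x<q
      (to∈ (∷ˡ⁻ (∷-⊆-++⁻ v (All<⇒∉ x<v) (∷⁻ (∷-⊆-++⁻ u (All<⇒∉ x<u) occ)))))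
    -- Past the first `x`, the letter `q` must come from `v` and the last two letters from
    -- `replicate b x`; this requires `v` nonempty and `b` at least two.
    no-min-1211 : ∀ {q} → Admissible b v → x < q → ¬ (x ∷ q ∷ x ∷ x ∷ [] ⊆ join′ x b u v)
    no-min-1211 adm x<q occ with ∷⁻ (∷-⊆-++⁻ u (All<⇒∉ x<u) occ)
    ... | qxx⊆ with adm
    ... | inj₂ refl = >⇒∉replicate b x<q (to∈ qxx⊆)
    ... | inj₁ b≤1  = <-irrefl refl (≤-trans (⊆.length-mono-≤ (∷-⊆-++⁻ v (All<⇒∉ x<v) (∷ˡ⁻ qxx⊆)))
                        (≤-trans (≤-reflexive (length-replicate b)) b≤1))

firstCopies : MinInsertion ((1 ∷ 2 ∷ 1 ∷ []) ∷ (1 ∷ 1 ∷ 1 ∷ 2 ∷ []) ∷ [])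
firstCopies = record
  { join           = join′
  ; join-↭         = λ x b u v → ↭.shifts u (replicate (suc b) x)
  ; join-filter    = join′-filter
  ; join-injective = join′-injective
  ; decompose      = decompose′
  ; compose        = compose′
  }
  where
  join′ : ℕ → ℕ → Word → Word → Word
  join′ x b u v = u ++ x ∷ replicate b x ++ v

  tail-filter : ∀ x b v → All (x <_) v → filter (x <?_) (replicate b x ++ v) ≡ v
  tail-filter x b v x<v = trans (filter-++ (x <?_) (replicate b x) v)
    (cong₂ _++_ (filter-<-replicate x b) (filter-all (x <?_) x<v))

  join′-filter : ∀ {x b u v} → All (x <_) u → All (x <_) v → filter (x <?_) (join′ x b u v) ≡ u ++ v
  join′-filter {x} {b} {u} {v} x<u x<v = trans (filter-<-++-∷ _ x<u) (cong (u ++_) (tail-filter x b v x<v))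

  join′-injective : ∀ {x b b′ u u′ v v′} → All (x <_) u → All (x <_) v → All (x <_) u′ → All (x <_) v′ →
                    join′ x b u v ≡ join′ x b′ u′ v′ → b ≡ b′ × u ≡ u′ × v ≡ v′
  join′-injective {x} {b} {b′} {v = v} {v′} x<u x<v x<u′ x<v′ eq
    with refl , tails ← ++-∷-injective x<u x<u′ eq
    with refl ← trans (sym (tail-filter x b v x<v)) (trans (cong (filter (x <?_)) tails) (tail-filter x b′ v′ x<v′))
    = replicate-length (++-cancelʳ v _ _ tails) , refl , refl

  decompose′ : ∀ {x π} → x ∈ π → All (x ≤_) π → AvoidsAll _ π →
               ∃[ b ] ∃₂ λ u v → π ≡ join′ x b u v × All (x <_) u × All (x <_) v × Admissible b v
  decompose′ {x} {π} x∈ x≤ (no-121 ∷ no-1112 ∷ [])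
    with u , s , refl , x<u , x≤s ← splitAtOccurringMin π x∈ x≤
    with b , v , refl , rest ← stripMin s x≤s
    with rest
  -- The first copy of `x`, then `q` and the later `x`, form 121; hence all copies of `x` are
  -- consecutive.
  ... | inj₂ (q , x<q , qx⊆v) =
        contradiction (twoLetters⇒contains _ x<q (⊆.++⁺ˡ u (refl ∷ ⊆.++⁺ˡ (replicate b x) qx⊆v))) no-121
  ... | inj₁ x<v = b , u , v , refl , x<u , x<v , admissible b v x<v no-1112
    where
    admissible : ∀ b v → All (x <_) v → join′ x b u v avoids (1 ∷ 1 ∷ 1 ∷ 2 ∷ []) → Admissible b v
    admissible 0             v       _         _   = inj₁ z≤n
    admissible 1             v       _         _   = inj₁ ≤-refl
    admissible (suc (suc b)) []      _         _   = inj₂ refl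
    admissible (suc (suc b)) (q ∷ v) (x<q ∷ _) avo = contradiction
      (twoLetters⇒contains _ x<q
        (⊆.++⁺ˡ u (refl ∷ refl ∷ refl ∷ ⊆.++⁺ˡ (replicate b x) (refl ∷ minimum v)))) avo

  compose′ : ∀ {x b u v} → All (x <_) u → All (x <_) v → Admissible b v →
             AvoidsAll ((1 ∷ 2 ∷ 1 ∷ []) ∷ (1 ∷ 1 ∷ 1 ∷ 2 ∷ []) ∷ []) (u ++ v) →
             AvoidsAll ((1 ∷ 2 ∷ 1 ∷ []) ∷ (1 ∷ 1 ∷ 1 ∷ 2 ∷ []) ∷ []) (join′ x b u v)
  compose′ {x} {b} {u} {v} x<u x<v adm (no-121 ∷ no-1112 ∷ []) =
    avoids-by-min _ all≥1 x≤ eq no-121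
      (λ { f mono refl occ → no-min-121 (mono (here refl) (there (here refl)) (n<1+n 1)) occ }) ∷
    avoids-by-min _ all≥1 x≤ eq no-1112
      (λ { f mono refl occ → no-min-1112 b adm (mono (here refl) (there (there (there (here refl)))) (n<1+n 1))
                               (∷⁻ (∷-⊆-++⁻ u (All<⇒∉ x<u) occ)) }) ∷ []
    where
    eq = join′-filter {b = b} x<u x<v
    x≤ : All (x ≤_) (join′ x b u v)
    x≤ = All.++⁺ (All.map <⇒≤ x<u) (≤-refl ∷ All.++⁺ (All.replicate⁺ b ≤-refl) (All.map <⇒≤ x<v))
    no-min-121 : ∀ {q} → x < q → ¬ (x ∷ q ∷ x ∷ [] ⊆ join′ x b u v)
    no-min-121 x<q occ = All<⇒∉ x<v
      (to∈ (∷ˡ⁻ (∷-⊆-++⁻ (replicate b x) (>⇒∉replicate b x<q) (∷⁻ (∷-⊆-++⁻ u (All<⇒∉ x<u) occ)))))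
    -- The first letter of 1112 has already been matched with the first copy of `x`, leaving
    -- `x x q`. With `b` at most one, some `x` would have to come from `v`; with `v` empty, there is
    -- no `q`.
    no-min-1112 : ∀ {q} b → Admissible b v → x < q → ¬ (x ∷ x ∷ q ∷ [] ⊆ replicate b x ++ v)
    no-min-1112 b (inj₂ refl) x<q occ =
      >⇒∉replicate b x<q (to∈ (∷ˡ⁻ (∷ˡ⁻ (subst (_ ⊆_) (++-identityʳ (replicate b x)) occ))))
    no-min-1112 0             (inj₁ _)       x<q occ = All<⇒∉ x<v (to∈ occ)
    no-min-1112 1             (inj₁ _)       x<q occ = All<⇒∉ x<v (to∈ (∷⁻ occ))
    no-min-1112 (suc (suc b)) (inj₁ (s≤s ())) x<q occ

112,1211∼121,1112 : ((1 ∷ 1 ∷ 2 ∷ []) ∷ (1 ∷ 2 ∷ 1 ∷ 1 ∷ []) ∷ []) ∼ ((1 ∷ 2 ∷ 1 ∷ []) ∷ (1 ∷ 1 ∷ 1 ∷ 2 ∷ []) ∷ [])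
112,1211∼121,1112 S = ≤-antisym
  (av-≤-by-minInsertion {J = lastCopies} {K = firstCopies} ([]-avoids _ _ ∷ []-avoids _ _ ∷ []) S)
  (av-≤-by-minInsertion {J = firstCopies} {K = lastCopies} ([]-avoids _ _ ∷ []-avoids _ _ ∷ []) S)

theorem2p10 : (((1 ∷ 1 ∷ 1 ∷ []) ∷ (1 ∷ 2 ∷ 2 ∷ 1 ∷ []) ∷ []) ∼ ((1 ∷ 1 ∷ 1 ∷ []) ∷ (2 ∷ 1 ∷ 1 ∷ 2 ∷ []) ∷ []))
    ×
    (((1 ∷ 1 ∷ 2 ∷ []) ∷ (1 ∷ 2 ∷ 1 ∷ 1 ∷ []) ∷ []) ∼ ((1 ∷ 2 ∷ 1 ∷ []) ∷ (1 ∷ 1 ∷ 1 ∷ 2 ∷ []) ∷ []))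
theorem2p10 = 111,1221∼111,2112 , 112,1211∼121,1112
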